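{- Let $G=\langle W_1,\dots,W_n\mid R_1,\dots,R_m\rangle$ be a finitely presented group with $n\ge2$ generators and at least one relator $R_i$ that is nontrivial in the free group on $W_1,\dots,W_n$, and let $a,b$ be words in $W_1^{\pm1},\dots,W_n^{\pm1}$. Then $a=b$ in $G$ if and only if $FTL_B(G,a)$ and $FTL_B(G,b)$ are Hurwitz equivalent.
   Context: Conjugation notation: $a^b=b^{ -1}ab$. Let $F_n$ be free on $z_1,\dots,z_n$ and $\varphi$ the rewriting map from words in $W_i^{\pm1}$ to words in $F_n$ replacing $W_i^{\pm1}$ by $z_i^{\pm1}$. Let $V=(\varphi(R_1),\dots,\varphi(R_m))=(v_1,\dots,v_m)$ and $N$ the normal closure of $\{v_1,\dots,v_m\}$ in $F_n$. For $G_1\oplus G_2$, $R=(R'_1,\dots,R'_p)$, $W=(W'_1,\dots,W'_q)$, $H$ in $G_1$ and $X=(X_1,\dots,X_{q+2})$ in $G_2$, let $P_X(R,W,H)=((R'_1,1),\dots,(R'_p,1),(W'_1,X_1),\dots,(W'_q,X_q),(H^{ -1},X_{q+1}),(H,X_{q+2}))$. Let $F_X$ be free on $X_1,\dots,X_{n+1}$ and fix an injective homomorphism $i:F_n\oplus F_X\to F_2\oplus F_2$. For a word $c$ in $F_n$, $FTL_{s1}(c)=i(P_X(V_f,W,c))$ with $V_f=(v_1,\dots,v_m,(v_1\cdots v_m)^{ -1})$, $W=(z_1,\dots,z_n,(z_1\cdots z_n)^{ -1})$, $X=(X_1,\dots,X_n,(X_1\cdots X_n)^{ -1},X_{n+1}^{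 -1},X_{n+1})$. Fix $H\in N$ with no root (i.e. not of the form $w^k$ with $k\neq\pm1$), and set $FTL_{s2}(c)=FTL_{s1}(H^c)$. Finally $FTL_B(G,a)=FTL_{s2}(\varphi(a))$, a $1$-factorization in $F_2\oplus F_2$. The braid group acts on the right on tuples by $(f_1,\dots,f_k)\sigma_i=(\dots,f_{i-1},f_{i+1},f_{i+1}^{ -1}f_if_{i+1},f_{i+2},\dots)$, $(f_1,\dots,f_k)\sigma_i^{ -1}=(\dots,f_{i-1},f_if_{i+1}f_i^{ -1},f_i,f_{i+2},\dots)$; Hurwitz equivalent means in the same orbit. -}

module Defs where

open import Data.Nat using (ℕ; suc; _≤_)
open import Data.Fin using (Fin; inject₁; fromℕ)
open import Data.Bool using (Bool; true; false; not)
open import Data.Integer using (ℤ; +_; -[1+_]; _≟_)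
open import Data.List using (List; []; _∷_; _++_; map; reverse; concat; concatMap; zip; length; lookup; allFin; [_])
open import Data.List.Relation.Unary.Any using (Any)
open import Data.Product using (_×_; _,_; Σ; proj₁; proj₂; Σ-syntax)
open import Relation.Nullary using (¬_)
open import Relation.Binary.PropositionalEquality using (_≡_)

-- Free group F_n on generators Fin n: words of letters (generator, inverted?)

Letter : ℕ → Set
Letter n = Fin n × Bool     -- (j , false) = z_j ,  (j , true) = z_j⁻¹

Word : ℕ → Set
Word n = List (Letter n)

invL : ∀ {n} → Letter n → Letter n
invL (j , b) = (j , not b)

inv : ∀ {n} → Word n → Word n
inv w = reverse (map invL w)

gen : ∀ {n} → Fin n → Word n
gen j = [ (j , false) ]

powℕ : ∀ {n} → Word n → ℕ → Word n
powℕ w ℕ.zero = []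
powℕ w (suc k) = w ++ powℕ w k

pow : ∀ {n} → Word n → ℤ → Word n
pow w (+ k) = powℕ w k
pow w -[1+ k ] = powℕ (inv w) (suc k)

conj : ∀ {n} → Word n → Word n → Word n
conj a b = inv b ++ a ++ b

data _≈_ {n : ℕ} : Word n → Word n → Set where
  ≈-refl   : ∀ {u} → u ≈ u
  ≈-sym    : ∀ {u v} → u ≈ v → v ≈ u
  ≈-trans  : ∀ {u v w} → u ≈ v → v ≈ w → u ≈ w
  ≈-cancel : ∀ u x v → (u ++ x ∷ invL x ∷ v) ≈ (u ++ v)

infix 4 _≈_

-- Presentations G = ⟨ W_1..W_n | R_1..R_m ⟩ : relators as a list of words
-- (φ is the identity under this encoding: W_j is written as generator j).

InN : ∀ {n} → (R : List (Word n)) → Word n → Set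
InN {n} R w =
  Σ[ cs ∈ List (Word n × Fin (length R) × Bool) ]
    w ≈ concatMap (λ { (g , j , false) → conj (lookup R j) g
                     ; (g , j , true)  → conj (inv (lookup R j)) g }) cs

EqInG : ∀ {n} → List (Word n) → Word n → Word n → Set
EqInG R a b = InN R (a ++ inv b)

NoRoot : ∀ {n} → Word n → Set
NoRoot {n} H = (w : Word n) (k : ℤ) → ¬ (k ≡ + 1) → ¬ (k ≡ -[1+ 0 ]) → ¬ (H ≈ pow w k)

_≈₂_ : ∀ {p q} → Word p × Word q → Word p × Word q → Set
(a , b) ≈₂ (c , d) = (a ≈ c) × (b ≈ d)

_·₂_ : ∀ {p q} → Word p × Word q → Word p × Word q → Word p × Word q
(a , b) ·₂ (c , d) = (a ++ c , b ++ d)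

inv₂ : ∀ {p q} → Word p × Word q → Word p × Word q
inv₂ (a , b) = (inv a , inv b)

record InjHom (n : ℕ) : Set where
  field
    fun  : Word n × Word (suc n) → Word 2 × Word 2
    resp : ∀ {x y} → x ≈₂ y → fun x ≈₂ fun y
    hom  : ∀ x y → fun (x ·₂ y) ≈₂ (fun x ·₂ fun y)
    inj  : ∀ {x y} → fun x ≈₂ fun y → x ≈₂ y
open InjHom public

P_X : ∀ {p q} → List (Word p) → List (Word p) → Word p
      → List (Word q) → Word q → Word q → List (Word p × Word q)
P_X Rs Ws H Xs x₁ x₂ =
  map (λ r → (r , [])) Rs ++ zip Ws Xs ++ ((inv H , x₁) ∷ (H , x₂) ∷ [])

module FTL {n : ℕ} (R : List (Word n)) (i : InjHom n) (H : Word n) where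
  Vf : List (Word n)
  Vf = R ++ [ inv (concat R) ]

  Ws : List (Word n)
  Ws = map gen (allFin n) ++ [ inv (concat (map gen (allFin n))) ]

  Xgen : Fin n → Word (suc n)
  Xgen j = gen (inject₁ j)

  Xn+1 : Word (suc n)
  Xn+1 = gen (fromℕ n)

  Xs : List (Word (suc n))
  Xs = map Xgen (allFin n) ++ [ inv (concat (map Xgen (allFin n))) ]

  FTL-s1 : Word n → List (Word 2 × Word 2)
  FTL-s1 c = map (fun i) (P_X Vf Ws c Xs (inv Xn+1) Xn+1)

  FTL-s2 : Word n → List (Word 2 × Word 2)
  FTL-s2 c = FTL-s1 (conj H c)

  FTL-B : Word n → List (Word 2 × Word 2)
  FTL-B a = FTL-s2 a

Tuple : Set
Tuple = List (Word 2 × Word 2)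

data BraidStep : Tuple → Tuple → Set where
  σ     : ∀ f g t → BraidStep (f ∷ g ∷ t) (g ∷ (inv₂ g ·₂ (f ·₂ g)) ∷ t)
  σ⁻¹   : ∀ f g t → BraidStep (f ∷ g ∷ t) ((f ·₂ (g ·₂ inv₂ f)) ∷ f ∷ t)
  there : ∀ h {t t'} → BraidStep t t' → BraidStep (h ∷ t) (h ∷ t')

data PwEq : Tuple → Tuple → Set where
  []  : PwEq [] []
  _∷_ : ∀ {x y t t'} → x ≈₂ y → PwEq t t' → PwEq (x ∷ t) (y ∷ t')

-- Hurwitz equivalence: same orbit under the braid action on tuples of
-- group elements (tuples compared entrywise in F_2 ⊕ F_2)
data Hurwitz : Tuple → Tuple → Set where
  h-eq    : ∀ {s t} → PwEq s t → Hurwitz s t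
  h-step  : ∀ {s t} → BraidStep s t → Hurwitz s t
  h-sym   : ∀ {s t} → Hurwitz s t → Hurwitz t s
  h-trans : ∀ {s t u} → Hurwitz s t → Hurwitz t u → Hurwitz s u

{-# OPTIONS --safe #-}

-- Equality in G gives Hurwitz equivalence because an adjacent pair (y⁻¹, y) passes through a tuple
-- unchanged, and can be conjugated on the way by any entry, hence by the normal closure N.
-- Conversely, let S be the subgroup generated by the tuple of c = H^a. Hurwitz moves keep every entry
-- inside the S-conjugates of the original entries, and the exponent sum of X_{n+1} singles out those of
-- (c, X_{n+1}), so (H^b, X_{n+1}) = (c, X_{n+1})^(g, x) with (g, x) ∈ S. Modulo N, g is the image of x
-- under X_j ↦ z_j, X_{n+1} ↦ 1; as x commutes with X_{n+1}, it is a power of X_{n+1} and g ∈ N.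
-- Finally a g b⁻¹ centralises H, which has no root, so it is a power of H and lies in N.

module Submission where

open import Defs
open import Data.Bool using (false; true)
import Data.Bool.Properties as Bool
open import Data.Fin using (Fin; zero; suc; inject₁; fromℕ)
import Data.Fin.Properties as Fin
open import Data.Fin.Relation.Unary.Top using (view; ‵fromℕ; ‵inject₁; view-fromℕ; view-inject₁)
open import Data.Integer as ℤ using (ℤ; +_; -[1+_]; _+_; _*_; -_; ∣_∣)
import Data.Integer.Properties as ℤ
open import Data.Integer.Tactic.RingSolver using (solve-∀)
open import Data.List using (List; []; _∷_; _++_; _∷ʳ_; [_]; map; reverse; concat; concatMap; zip; length; lookup; foldr; allFin; initLast; _∷ʳ′_)
import Data.List.Properties as List
open import Data.List.Membership.Propositional using (_∈_)
open import Data.List.Membership.Propositional.Properties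
  using (∈-map⁺; ∈-++⁺ˡ; ∈-++⁺ʳ; ∈-lookup; ∈-allFin; ∈-∃++)
open import Data.List.Relation.Unary.All as All using (All; []; _∷_; universal)
open import Data.List.Relation.Unary.All.Properties using (++⁺; ++⁻ʳ; map⁺)
open import Data.List.Relation.Unary.Any using (Any; index)
open import Data.List.Relation.Unary.Any.Properties using (lookup-index)
open import Data.List.Relation.Unary.Linked as Linked using (Linked; []; [-]; _∷_)
open import Data.Nat using (ℕ; zero; suc; _≤_; z≤n; s≤s; s≤s⁻¹) renaming (_+_ to _+ℕ_)
import Data.Nat.Properties as ℕ
open import Data.Product using (_×_; _,_; ∃; Σ-syntax; proj₁; proj₂)
open import Data.Product.Properties using (≡-dec)
open import Data.Sum using (_⊎_; inj₁; inj₂)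
open import Data.Vec as Vec using (Vec; []; _∷_)
open import Function using (_∘_)
open import Function.Bundles using (_⇔_; mk⇔; module Equivalence)
open import Relation.Binary.Bundles using (Setoid)
open import Relation.Binary.Definitions using (DecidableEquality)
open import Relation.Binary.PropositionalEquality
  using (_≡_; _≢_; refl; sym; trans; cong; cong₂; subst; subst₂; module ≡-Reasoning)
import Relation.Binary.Reasoning.Setoid as SetoidReasoning
open import Relation.Nullary using (¬_; yes; no; contradiction)

private variable
  k n p q : ℕ

-- The free group as a setoid group

≈-reflexive : {u v : Word n} → u ≡ v → u ≈ v
≈-reflexive refl = ≈-refl

≈-setoid : ℕ → Setoid _ _
≈-setoid n = record
  { Carrier = Word n ; _≈_ = _≈_
  ; isEquivalence = record { refl = ≈-refl ; sym = ≈-sym ; trans = ≈-trans } }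

module ≈-Reasoning {n} = SetoidReasoning (≈-setoid n)

++-congˡ : (w : Word n) {u v : Word n} → u ≈ v → w ++ u ≈ w ++ v
++-congˡ w ≈-refl = ≈-refl
++-congˡ w (≈-sym e) = ≈-sym (++-congˡ w e)
++-congˡ w (≈-trans e f) = ≈-trans (++-congˡ w e) (++-congˡ w f)
++-congˡ w (≈-cancel u x v) =
  subst₂ _≈_ (List.++-assoc w u _) (List.++-assoc w u v) (≈-cancel (w ++ u) x v)

++-congʳ : (w : Word n) {u v : Word n} → u ≈ v → u ++ w ≈ v ++ w
++-congʳ w ≈-refl = ≈-refl
++-congʳ w (≈-sym e) = ≈-sym (++-congʳ w e)
++-congʳ w (≈-trans e f) = ≈-trans (++-congʳ w e) (++-congʳ w f)
++-congʳ w (≈-cancel u x v) =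
  subst₂ _≈_ (sym (List.++-assoc u _ w)) (sym (List.++-assoc u v w)) (≈-cancel u x (v ++ w))

++-cong : {u u′ v v′ : Word n} → u ≈ u′ → v ≈ v′ → u ++ v ≈ u′ ++ v′
++-cong {u′ = u′} {v} e f = ≈-trans (++-congʳ v e) (++-congˡ u′ f)

invL-involutive : (x : Letter n) → invL (invL x) ≡ x
invL-involutive (j , b) = cong (j ,_) (Bool.not-involutive b)

inv-∷ : (x : Letter n) (w : Word n) → inv (x ∷ w) ≡ inv w ++ [ invL x ]
inv-∷ x w = List.unfold-reverse (invL x) (map invL w)

inv-++ : (u v : Word n) → inv (u ++ v) ≡ inv v ++ inv u
inv-++ u v = trans (cong reverse (List.map-++ invL u v)) (List.reverse-++ (map invL u) (map invL v))

inv-involutive : (w : Word n) → inv (inv w) ≡ w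
inv-involutive [] = refl
inv-involutive (x ∷ w) = begin
  inv (inv (x ∷ w))              ≡⟨ cong inv (inv-∷ x w) ⟩
  inv (inv w ++ [ invL x ])      ≡⟨ inv-++ (inv w) [ invL x ] ⟩
  invL (invL x) ∷ inv (inv w)    ≡⟨ cong₂ _∷_ (invL-involutive x) (inv-involutive w) ⟩
  x ∷ w                          ∎
  where open ≡-Reasoning

inverseʳ : (w : Word n) → w ++ inv w ≈ []
inverseʳ [] = ≈-refl
inverseʳ (x ∷ w) = begin
  x ∷ w ++ inv (x ∷ w)              ≡⟨ cong (λ t → x ∷ w ++ t) (inv-∷ x w) ⟩
  x ∷ w ++ inv w ++ [ invL x ]      ≡⟨ cong (x ∷_) (sym (List.++-assoc w _ _)) ⟩
  x ∷ (w ++ inv w) ++ [ invL x ]    ≈⟨ ++-congˡ [ x ] (++-congʳ [ invL x ] (inverseʳ w)) ⟩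
  x ∷ invL x ∷ []                   ≈⟨ ≈-cancel [] x [] ⟩
  []                                ∎
  where open ≈-Reasoning

inverseˡ : (w : Word n) → inv w ++ w ≈ []
inverseˡ w = subst (λ t → inv w ++ t ≈ []) (inv-involutive w) (inverseʳ (inv w))

inv-unique : (u v : Word n) → u ++ v ≈ [] → v ≈ inv u
inv-unique u v e = begin
  v                    ≈⟨ ++-congʳ v (inverseˡ u) ⟨
  (inv u ++ u) ++ v    ≡⟨ List.++-assoc (inv u) u v ⟩
  inv u ++ u ++ v      ≈⟨ ++-congˡ (inv u) e ⟩
  inv u ++ []          ≡⟨ List.++-identityʳ (inv u) ⟩
  inv u                ∎
  where open ≈-Reasoning

inv-cong : {u v : Word n} → u ≈ v → inv u ≈ inv v
inv-cong {u = u} {v} e = inv-unique v (inv u) (≈-trans (++-congʳ (inv u) (≈-sym e)) (inverseʳ u))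

-- Free reduction

infix 4 _≟L_
infixr 5 _▷_

_≟L_ : DecidableEquality (Letter n)
_≟L_ = ≡-dec Fin._≟_ Bool._≟_

_▷_ : Letter n → Word n → Word n
x ▷ [] = [ x ]
x ▷ (y ∷ w) with y ≟L invL x
... | yes _ = w
... | no _ = x ∷ y ∷ w

norm : Word n → Word n
norm = foldr _▷_ []

Reduced : Word n → Set
Reduced = Linked (λ x y → y ≢ invL x)

▷-reduced : (x : Letter n) {w : Word n} → Reduced w → Reduced (x ▷ w)
▷-reduced x [] = [-]
▷-reduced x {y ∷ w} r with y ≟L invL x
... | yes _ = Linked.tail r
... | no y≢ = y≢ ∷ r

norm-reduced : (w : Word n) → Reduced (norm w)
norm-reduced [] = []
norm-reduced (x ∷ w) = ▷-reduced x (norm-reduced w)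

▷-reduced-∷ : (x : Letter n) {w : Word n} → Reduced (x ∷ w) → x ▷ w ≡ x ∷ w
▷-reduced-∷ x [-] = refl
▷-reduced-∷ x {y ∷ w} (y≢ ∷ _) with y ≟L invL x
... | yes y≡ = contradiction y≡ y≢
... | no _ = refl

norm-of-reduced : {w : Word n} → Reduced w → norm w ≡ w
norm-of-reduced {w = []} r = refl
norm-of-reduced {w = x ∷ w} r =
  trans (cong (x ▷_) (norm-of-reduced (Linked.tail r))) (▷-reduced-∷ x r)

-- Van der Waerden's trick: letters act on reduced words, and here a letter undoes the action of its
-- inverse, so the action factors through the free group. This makes `norm` independent of the
-- representing word.
▷-cancel : (x : Letter n) {w : Word n} → Reduced w → x ▷ (invL x ▷ w) ≡ w
▷-cancel x {[]} r with invL x ≟L invL x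
... | yes _ = refl
... | no ≢ = contradiction refl ≢
▷-cancel x {y ∷ w} r with y ≟L invL (invL x)
... | yes y≡ rewrite trans y≡ (invL-involutive x) = ▷-reduced-∷ x r
... | no _ with invL x ≟L invL x
...   | yes _ = refl
...   | no ≢ = contradiction refl ≢

norm-cong : {u v : Word n} → u ≈ v → norm u ≡ norm v
norm-cong ≈-refl = refl
norm-cong (≈-sym e) = sym (norm-cong e)
norm-cong (≈-trans e f) = trans (norm-cong e) (norm-cong f)
norm-cong (≈-cancel [] x v) = ▷-cancel x (norm-reduced v)
norm-cong (≈-cancel (y ∷ u) x v) = cong (y ▷_) (norm-cong (≈-cancel u x v))

▷-≈ : (x : Letter n) (w : Word n) → x ▷ w ≈ x ∷ w
▷-≈ x [] = ≈-refl
▷-≈ x (y ∷ w) with y ≟L invL x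
... | yes refl = ≈-sym (≈-cancel [] x w)
... | no _ = ≈-refl

norm-≈ : (w : Word n) → norm w ≈ w
norm-≈ [] = ≈-refl
norm-≈ (x ∷ w) = ≈-trans (▷-≈ x (norm w)) (++-congˡ [ x ] (norm-≈ w))

▷-length : (x : Letter n) (w : Word n) → length (x ▷ w) ≤ suc (length w)
▷-length x [] = ℕ.≤-refl
▷-length x (y ∷ w) with y ≟L invL x
... | yes _ = ℕ.m≤n+m (length w) 2
... | no _ = ℕ.≤-refl

norm-length : (w : Word n) → length (norm w) ≤ length w
norm-length [] = z≤n
norm-length (x ∷ w) = ℕ.≤-trans (▷-length x (norm w)) (s≤s (norm-length w))

▷-length-maximal : (x : Letter n) (w : Word n) → suc (length w) ≤ length (x ▷ w) → x ▷ w ≡ x ∷ w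
▷-length-maximal x [] _ = refl
▷-length-maximal x (y ∷ w) le with y ≟L invL x
... | yes _ = contradiction (ℕ.≤-trans (ℕ.n≤1+n _) le) ℕ.1+n≰n
... | no _ = refl

-- Each letter of the fold adds at most one to the length and a cancellation removes one, so a word
-- that loses no length has met no cancellation.
norm-length-maximal : (w : Word n) → length w ≤ length (norm w) → norm w ≡ w
norm-length-maximal [] _ = refl
norm-length-maximal (x ∷ w) le =
  trans (▷-length-maximal x (norm w) (ℕ.≤-trans (s≤s (norm-length w)) le))
        (cong (x ∷_) (norm-length-maximal w (s≤s⁻¹ (ℕ.≤-trans le (▷-length x (norm w))))))

-- Substitution, and a solver for group identities

substL : (Fin k → Word n) → Letter k → Word n
substL ρ (j , false) = ρ j
substL ρ (j , true) = inv (ρ j)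

substW : (Fin k → Word n) → Word k → Word n
substW ρ = concatMap (substL ρ)

substL-invL : (ρ : Fin k → Word n) (x : Letter k) → substL ρ (invL x) ≡ inv (substL ρ x)
substL-invL ρ (j , false) = refl
substL-invL ρ (j , true) = sym (inv-involutive (ρ j))

substW-++ : (ρ : Fin k → Word n) (u v : Word k) → substW ρ (u ++ v) ≡ substW ρ u ++ substW ρ v
substW-++ ρ = List.concatMap-++ (substL ρ)

substW-cong : (ρ : Fin k → Word n) {u v : Word k} → u ≈ v → substW ρ u ≈ substW ρ v
substW-cong ρ ≈-refl = ≈-refl
substW-cong ρ (≈-sym e) = ≈-sym (substW-cong ρ e)
substW-cong ρ (≈-trans e f) = ≈-trans (substW-cong ρ e) (substW-cong ρ f)
substW-cong ρ (≈-cancel u x v) = begin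
  substW ρ (u ++ x ∷ invL x ∷ v)
    ≡⟨ substW-++ ρ u _ ⟩
  substW ρ u ++ substL ρ x ++ substL ρ (invL x) ++ substW ρ v
    ≡⟨ cong (λ t → substW ρ u ++ substL ρ x ++ t ++ substW ρ v) (substL-invL ρ x) ⟩
  substW ρ u ++ substL ρ x ++ inv (substL ρ x) ++ substW ρ v
    ≡⟨ cong (substW ρ u ++_) (sym (List.++-assoc (substL ρ x) _ _)) ⟩
  substW ρ u ++ (substL ρ x ++ inv (substL ρ x)) ++ substW ρ v
    ≈⟨ ++-congˡ (substW ρ u) (++-congʳ (substW ρ v) (inverseʳ (substL ρ x))) ⟩
  substW ρ u ++ substW ρ v
    ≡⟨ sym (substW-++ ρ u v) ⟩
  substW ρ (u ++ v) ∎
  where open ≈-Reasoning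

substW-inv : (ρ : Fin k → Word n) (u : Word k) → substW ρ (inv u) ≈ inv (substW ρ u)
substW-inv ρ u = inv-unique (substW ρ u) (substW ρ (inv u))
  (≈-trans (≈-reflexive (sym (substW-++ ρ u (inv u)))) (substW-cong ρ (inverseʳ u)))

infixr 6 _⊙_
infixl 7 _^^_
infix 8 _⁻

data Expr (k : ℕ) : Set where
  𝟙   : Expr k
  var : Fin k → Expr k
  _⊙_ : Expr k → Expr k → Expr k
  _⁻  : Expr k → Expr k

⟦_⟧ : Expr k → (Fin k → Word n) → Word n
⟦ 𝟙 ⟧ ρ = []
⟦ var j ⟧ ρ = ρ j
⟦ e ⊙ f ⟧ ρ = ⟦ e ⟧ ρ ++ ⟦ f ⟧ ρ
⟦ e ⁻ ⟧ ρ = inv (⟦ e ⟧ ρ)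

⟦⟧-gen : (ρ : Fin k → Word n) (e : Expr k) → ⟦ e ⟧ ρ ≈ substW ρ (⟦ e ⟧ gen)
⟦⟧-gen ρ 𝟙 = ≈-refl
⟦⟧-gen ρ (var j) = ≈-reflexive (sym (List.++-identityʳ (ρ j)))
⟦⟧-gen ρ (e ⊙ f) =
  ≈-trans (++-cong (⟦⟧-gen ρ e) (⟦⟧-gen ρ f)) (≈-reflexive (sym (substW-++ ρ (⟦ e ⟧ gen) (⟦ f ⟧ gen))))
⟦⟧-gen ρ (e ⁻) = ≈-trans (inv-cong (⟦⟧-gen ρ e)) (≈-sym (substW-inv ρ (⟦ e ⟧ gen)))

-- An identity that holds for the free generators holds for all words.
solve′ : (ρ : Fin k → Word n) (e f : Expr k) → norm (⟦ e ⟧ gen) ≡ norm (⟦ f ⟧ gen) →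
         ⟦ e ⟧ ρ ≈ ⟦ f ⟧ ρ
solve′ ρ e f eq = begin
  ⟦ e ⟧ ρ                    ≈⟨ ⟦⟧-gen ρ e ⟩
  substW ρ (⟦ e ⟧ gen)        ≈⟨ substW-cong ρ e≈f ⟩
  substW ρ (⟦ f ⟧ gen)        ≈⟨ ⟦⟧-gen ρ f ⟨
  ⟦ f ⟧ ρ                    ∎
  where
  open ≈-Reasoning
  e≈f : ⟦ e ⟧ gen ≈ ⟦ f ⟧ gen
  e≈f = ≈-trans (≈-sym (norm-≈ _)) (≈-trans (≈-reflexive eq) (norm-≈ _))

-- For concrete expressions both normal forms are closed terms, so the side condition is proved by
-- `refl`.
solve : (ρ : Vec (Word n) k) (e f : Expr k) → norm (⟦ e ⟧ gen) ≡ norm (⟦ f ⟧ gen) →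
        ⟦ e ⟧ (Vec.lookup ρ) ≈ ⟦ f ⟧ (Vec.lookup ρ)
solve ρ = solve′ (Vec.lookup ρ)

pattern x₀ = var zero
pattern x₁ = var (suc zero)
pattern x₂ = var (suc (suc zero))
pattern x₃ = var (suc (suc (suc zero)))

_^^_ : Expr k → Expr k → Expr k
e ^^ f = f ⁻ ⊙ e ⊙ f

conj-cong : {u v : Word n} (g : Word n) → u ≈ v → conj u g ≈ conj v g
conj-cong g e = ++-congˡ (inv g) (++-congʳ g e)

-- Commuting words have a common root

Reduced-++ : (u : Word n) {x y : Letter n} {v : Word n} →
             Reduced (u ∷ʳ x) → Reduced (y ∷ v) → y ≢ invL x → Reduced (u ∷ʳ x ++ y ∷ v)
Reduced-++ [] r s y≢ = y≢ ∷ s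
Reduced-++ (a ∷ []) (a≢ ∷ r) s y≢ = a≢ ∷ Reduced-++ [] r s y≢
Reduced-++ (a ∷ b ∷ u) (a≢ ∷ r) s y≢ = a≢ ∷ Reduced-++ (b ∷ u) r s y≢

Reduced-init : (u : Word n) {x : Letter n} → Reduced (u ∷ʳ x) → Reduced u
Reduced-init [] r = []
Reduced-init (a ∷ []) r = [-]
Reduced-init (a ∷ b ∷ u) (a≢ ∷ r) = a≢ ∷ Reduced-init (b ∷ u) r

inv-reduced : {w : Word n} → Reduced w → Reduced (inv w)
inv-reduced [] = []
inv-reduced [-] = [-]
inv-reduced {w = x ∷ y ∷ w} (y≢ ∷ r) =
  subst Reduced (sym (trans (inv-∷ x (y ∷ w)) (cong (_∷ʳ invL x) (inv-∷ y w))))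
    (Reduced-++ (inv w) (subst Reduced (inv-∷ y w) (inv-reduced r)) [-]
      (λ e → y≢ (sym (trans e (invL-involutive y)))))

powℕ-+ : (w : Word n) (i j : ℕ) → powℕ w (i +ℕ j) ≡ powℕ w i ++ powℕ w j
powℕ-+ w zero j = refl
powℕ-+ w (suc i) j = trans (cong (w ++_) (powℕ-+ w i j)) (sym (List.++-assoc w _ _))

powℕ-cong : {u v : Word n} → u ≈ v → ∀ i → powℕ u i ≈ powℕ v i
powℕ-cong e zero = ≈-refl
powℕ-cong e (suc i) = ++-cong e (powℕ-cong e i)

powℕ-conj : (w g : Word n) (i : ℕ) → conj (powℕ w i) g ≈ powℕ (conj w g) i
powℕ-conj w g zero = solve (g ∷ []) (𝟙 ^^ x₀) 𝟙 refl
powℕ-conj w g (suc i) =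
  ≈-trans (solve (w ∷ powℕ w i ∷ g ∷ []) ((x₀ ⊙ x₁) ^^ x₂) (x₀ ^^ x₂ ⊙ x₁ ^^ x₂) refl)
          (++-congˡ (conj w g) (powℕ-conj w g i))

pow-conj : (w g : Word n) (i : ℤ) → conj (pow w i) g ≈ pow (conj w g) i
pow-conj w g (+ i) = powℕ-conj w g i
pow-conj w g -[1+ i ] =
  ≈-trans (powℕ-conj (inv w) g (suc i))
          (powℕ-cong (solve (w ∷ g ∷ []) (x₀ ⁻ ^^ x₁) ((x₀ ^^ x₁) ⁻) refl) (suc i))

inv-powℕ : (w : Word n) (i : ℕ) → inv (powℕ w i) ≈ pow w (- (+ i))
inv-powℕ w zero = ≈-refl
-- `- (+ suc i)` computes to `-[1+ i ]`, so the goal is about a natural power of `inv w`; the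
-- induction runs on that sign-free form.
inv-powℕ w (suc i) = go (suc i)
  where
  go : ∀ i → inv (powℕ w i) ≈ powℕ (inv w) i
  go zero = ≈-refl
  go (suc i) = begin
    inv (w ++ powℕ w i)          ≡⟨ cong inv (powℕ-comm i) ⟩
    inv (powℕ w i ++ w)          ≡⟨ inv-++ (powℕ w i) w ⟩
    inv w ++ inv (powℕ w i)      ≈⟨ ++-congˡ (inv w) (go i) ⟩
    inv w ++ powℕ (inv w) i      ∎
    where
    open ≈-Reasoning
    powℕ-comm : ∀ i → w ++ powℕ w i ≡ powℕ w i ++ w
    powℕ-comm zero = List.++-identityʳ w
    powℕ-comm (suc i) = trans (cong (w ++_) (powℕ-comm i)) (sym (List.++-assoc w _ w))

++-split : ∀ {A : Set} (a : List A) {b} c {d} → a ++ b ≡ c ++ d →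
           (∃ λ e → a ≡ c ++ e) ⊎ (∃ λ e → c ≡ a ++ e)
++-split [] c eq = inj₂ (c , refl)
++-split (x ∷ a) [] eq = inj₁ (x ∷ a , refl)
++-split (x ∷ a) (y ∷ c) eq with List.∷-injective eq
... | refl , eq′ with ++-split a c eq′
...   | inj₁ (e , refl) = inj₁ (e , refl)
...   | inj₂ (e , refl) = inj₂ (e , refl)

-- Euclid's algorithm on lengths: the shorter word is a prefix of the longer one, and what remains
-- of the longer one still commutes with it. The bound `N` on the total length drives the recursion.
commuting-lists : ∀ N (u v : Word n) → length u +ℕ length v ≤ N → u ++ v ≡ v ++ u →
                  Σ[ w ∈ Word n ] Σ[ i ∈ ℕ ] Σ[ j ∈ ℕ ] u ≡ powℕ w i × v ≡ powℕ w j
commuting-lists N [] v le eq = v , 0 , 1 , refl , sym (List.++-identityʳ v)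
commuting-lists N u@(_ ∷ _) [] le eq = u , 1 , 0 , sym (List.++-identityʳ u) , refl
commuting-lists (suc N) u@(_ ∷ u′) v@(_ ∷ v′) le eq with ++-split u v eq
... | inj₁ (e , u≡) = case (commuting-lists N v e le′ eq′)
  where
  |u| : length u ≡ length v +ℕ length e
  |u| = trans (cong length u≡) (List.length-++ v)
  le′ : length v +ℕ length e ≤ N
  le′ = subst (_≤ N) |u| (s≤s⁻¹ (ℕ.≤-trans (ℕ.m≤m+n _ _) (subst (_≤ suc N) (ℕ.+-suc _ (length v′)) le)))
  eq′ : v ++ e ≡ e ++ v
  eq′ = List.++-cancelˡ v _ _ (sym (trans (sym (List.++-assoc v e v))
          (subst (λ t → t ++ v ≡ v ++ t) u≡ eq)))
  case : _ → _
  case (w , i , j , v≡ , e≡) =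
    w , i +ℕ j , i , trans u≡ (trans (cong₂ _++_ v≡ e≡) (sym (powℕ-+ w i j))) , v≡
... | inj₂ (e , v≡) = case (commuting-lists N u e le′ eq′)
  where
  |v| : length v ≡ length u +ℕ length e
  |v| = trans (cong length v≡) (List.length-++ u)
  le′ : length u +ℕ length e ≤ N
  le′ = subst (_≤ N) |v| (ℕ.≤-trans (ℕ.m≤n+m _ (length u′)) (s≤s⁻¹ le))
  eq′ : u ++ e ≡ e ++ u
  eq′ = List.++-cancelˡ u _ _ (trans (subst (λ t → u ++ t ≡ t ++ u) v≡ eq) (List.++-assoc u e u))
  case : _ → _
  case (w , i , j , u≡ , e≡) =
    w , i , i +ℕ j , u≡ , trans v≡ (trans (cong₂ _++_ u≡ e≡) (sym (powℕ-+ w i j)))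

-- Integer exponents are used because the argument on lists may apply only after one of the two
-- words has been inverted.
CommonRoot : Word n → Word n → Set
CommonRoot {n} u v = Σ[ w ∈ Word n ] Σ[ i ∈ ℤ ] Σ[ j ∈ ℤ ] u ≈ pow w i × v ≈ pow w j

CommonRoot-conj : (u v g : Word n) → CommonRoot u v → CommonRoot (conj u g) (conj v g)
CommonRoot-conj u v g (w , i , j , u≈ , v≈) =
  conj w g , i , j , ≈-trans (conj-cong g u≈) (pow-conj w g i)
                   , ≈-trans (conj-cong g v≈) (pow-conj w g j)

CommonRoot-resp : {u u′ v v′ : Word n} → u ≈ u′ → v ≈ v′ → CommonRoot u v → CommonRoot u′ v′
CommonRoot-resp e f (w , i , j , u≈ , v≈) =
  w , i , j , ≈-trans (≈-sym e) u≈ , ≈-trans (≈-sym f) v≈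

-- If u ++ v is reduced then, by length, so is v ++ u, and the two coincide as lists.
commuting-reduced : (u v : Word n) → Reduced (u ++ v) → u ++ v ≈ v ++ u →
  Σ[ w ∈ Word n ] Σ[ i ∈ ℕ ] Σ[ j ∈ ℕ ] u ≡ powℕ w i × v ≡ powℕ w j
commuting-reduced u v r e = commuting-lists _ u v ℕ.≤-refl
  (trans (sym norm-vu) (norm-length-maximal (v ++ u) (ℕ.≤-reflexive |vu|)))
  where
  norm-vu : norm (v ++ u) ≡ u ++ v
  norm-vu = trans (sym (norm-cong e)) (norm-of-reduced r)
  |vu| : length (v ++ u) ≡ length (norm (v ++ u))
  |vu| = trans (List.length-++-comm v u) (cong length (sym norm-vu))

-- v is cyclically reduced, so at most one of u ++ v and u ++ inv v admits a cancellation.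
commuting-cyclically-reduced :
  (u v : Word n) {f e : Letter n} {v₀ v₁ : Word n} → v ≡ f ∷ v₀ → v ≡ v₁ ∷ʳ e → f ≢ invL e →
  Reduced u → Reduced v → u ++ v ≈ v ++ u → CommonRoot u v
commuting-cyclically-reduced u v {f} {e} {v₀} {v₁} v≡f v≡e f≢ ru rv c with initLast u
... | [] = v , + 0 , + 1 , ≈-refl , ≈-reflexive (sym (List.++-identityʳ v))
... | us ∷ʳ′ ℓ with f ≟L invL ℓ
...   | no f≢ℓ with commuting-reduced (us ∷ʳ ℓ) v
                     (subst (λ t → Reduced (us ∷ʳ ℓ ++ t)) (sym v≡f)
                       (Reduced-++ us ru (subst Reduced v≡f rv) f≢ℓ)) c
...     | w , i , j , u≡ , v≡ = w , + i , + j , ≈-reflexive u≡ , ≈-reflexive v≡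
commuting-cyclically-reduced _ v {f} {e} {v₀} {v₁} v≡f v≡e f≢ ru rv c | us ∷ʳ′ ℓ | yes f≡
  with commuting-reduced (us ∷ʳ ℓ) (inv v)
         (subst (λ t → Reduced (us ∷ʳ ℓ ++ t)) (sym inv-v)
           (Reduced-++ us ru (subst Reduced inv-v (inv-reduced rv)) e≢ℓ)) c′
  where
  inv-v : inv v ≡ invL e ∷ inv v₁
  inv-v = trans (cong inv v≡e) (inv-++ v₁ [ e ])
  -- The last letter of u already cancels against the first letter of v; if it also cancelled
  -- against the first letter of `inv v`, then v would not be cyclically reduced.
  e≢ℓ : invL e ≢ invL ℓ
  e≢ℓ eq = f≢ (trans f≡ (sym eq))
  c′ : us ∷ʳ ℓ ++ inv v ≈ inv v ++ us ∷ʳ ℓ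
  c′ = begin
    us ∷ʳ ℓ ++ inv v
      ≈⟨ solve (us ∷ʳ ℓ ∷ v ∷ []) (x₀ ⊙ x₁ ⁻) (x₁ ⁻ ⊙ (x₁ ⊙ x₀) ⊙ x₁ ⁻) refl ⟩
    inv v ++ (v ++ us ∷ʳ ℓ) ++ inv v
      ≈⟨ ++-congˡ (inv v) (++-congʳ (inv v) c) ⟨
    inv v ++ (us ∷ʳ ℓ ++ v) ++ inv v
      ≈⟨ solve (us ∷ʳ ℓ ∷ v ∷ []) (x₁ ⁻ ⊙ (x₀ ⊙ x₁) ⊙ x₁ ⁻) (x₁ ⁻ ⊙ x₀) refl ⟩
    inv v ++ us ∷ʳ ℓ ∎
    where open ≈-Reasoning
... | w , i , j , u≡ , v⁻≡ =
  w , + i , - (+ j) , ≈-reflexive u≡ ,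
  ≈-trans (≈-reflexive (trans (sym (inv-involutive v)) (cong inv v⁻≡))) (inv-powℕ w j)

-- Either the first and last letters of v are mutually inverse, and a simultaneous conjugation
-- strips both, or v is cyclically reduced and the previous case applies to the normal form of u.
commuting-with-reduced : ∀ N (u v : Word n) → length v ≤ N → Reduced v → u ++ v ≈ v ++ u → CommonRoot u v
commuting-with-reduced N u [] le r c =
  u , + 1 , + 0 , ≈-reflexive (sym (List.++-identityʳ u)) , ≈-refl
commuting-with-reduced (suc N) u (x ∷ v) le r c with initLast v
-- A single letter is both first and last, and no letter is its own inverse, so the word is
-- cyclically reduced.
... | [] = CommonRoot-resp (norm-≈ u) ≈-refl
  (commuting-cyclically-reduced (norm u) [ x ] {v₁ = []} refl refl (λ e → Bool.not-¬ refl (cong proj₂ e))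
    (norm-reduced u) r (≈-trans (++-congʳ [ x ] (norm-≈ u)) (≈-trans c (++-congˡ [ x ] (≈-sym (norm-≈ u))))))
... | m ∷ʳ′ y with y ≟L invL x
...   | no y≢ = CommonRoot-resp (norm-≈ u) ≈-refl
  (commuting-cyclically-reduced (norm u) v′ {v₁ = x ∷ m} refl refl
    (λ e → y≢ (sym (trans (cong invL e) (invL-involutive y))))
    (norm-reduced u) r (≈-trans (++-congʳ v′ (norm-≈ u)) (≈-trans c (++-congˡ v′ (≈-sym (norm-≈ u))))))
  where
  v′ = x ∷ m ∷ʳ y
-- The second word is now `x ∷ m ∷ʳ invL x`. Conjugating both words by x turns it into the shorter
-- m, and the common root found there is conjugated back.
...   | yes refl = CommonRoot-resp
  (solve (u ∷ [ x ] ∷ []) ((x₀ ^^ x₁) ^^ (x₁ ⁻)) x₀ refl)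
  (solve (m ∷ [ x ] ∷ []) (x₀ ^^ (x₁ ⁻)) (x₁ ⊙ x₀ ⊙ x₁ ⁻) refl)
  (CommonRoot-conj (conj u [ x ]) m (inv [ x ])
    (commuting-with-reduced N (conj u [ x ]) m le′ (Reduced-init m (Linked.tail r)) c′))
  where
  open ≈-Reasoning
  le′ : length m ≤ N
  le′ = ℕ.≤-trans (ℕ.≤-trans (ℕ.m≤m+n _ 1) (ℕ.≤-reflexive (sym (List.length-++ m)))) (s≤s⁻¹ le)
  c′ : conj u [ x ] ++ m ≈ m ++ conj u [ x ]
  c′ = begin
    conj u [ x ] ++ m
      ≈⟨ solve (u ∷ m ∷ [ x ] ∷ []) (x₀ ^^ x₂ ⊙ x₁) ((x₀ ⊙ x₂ ⊙ x₁ ⊙ x₂ ⁻) ^^ x₂) refl ⟩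
    conj (u ++ [ x ] ++ m ++ inv [ x ]) [ x ]
      ≈⟨ conj-cong [ x ] c ⟩
    conj (([ x ] ++ m ++ inv [ x ]) ++ u) [ x ]
      ≈⟨ solve (u ∷ m ∷ [ x ] ∷ []) (((x₂ ⊙ x₁ ⊙ x₂ ⁻) ⊙ x₀) ^^ x₂) (x₁ ⊙ x₀ ^^ x₂) refl ⟩
    m ++ conj u [ x ] ∎

commuting⇒commonRoot : (u v : Word n) → u ++ v ≈ v ++ u → CommonRoot u v
commuting⇒commonRoot u v c = CommonRoot-resp ≈-refl (norm-≈ v)
  (commuting-with-reduced _ u (norm v) ℕ.≤-refl (norm-reduced v)
    (≈-trans (++-congˡ u (norm-≈ v)) (≈-trans c (++-congʳ u (≈-sym (norm-≈ v))))))

-- Subgroups and centralizers of elements without roots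

record IsSubgroup (P : Word n → Set) : Set where
  field
    ≈∈   : ∀ {u v} → u ≈ v → P u → P v
    []∈  : P []
    ++∈  : ∀ {u v} → P u → P v → P (u ++ v)
    inv∈ : ∀ {u} → P u → P (inv u)

  powℕ∈ : ∀ {w} → P w → ∀ i → P (powℕ w i)
  powℕ∈ w∈ zero = []∈
  powℕ∈ w∈ (suc i) = ++∈ w∈ (powℕ∈ w∈ i)

  pow∈ : ∀ {w} → P w → ∀ i → P (pow w i)
  pow∈ w∈ (+ i) = powℕ∈ w∈ i
  pow∈ w∈ -[1+ i ] = powℕ∈ (inv∈ w∈) (suc i)

  -- Commuting words are powers of one w, and absence of roots forces v to be w or its inverse; so u
  -- is a power of v and lies in every subgroup containing v. This serves twice: for X_{n+1} and the
  -- kernel of `ψ`, and for H and N.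
  centralizer∈ : ∀ {u v} → NoRoot v → P v → u ++ v ≈ v ++ u → P u
  centralizer∈ {u} {v} noRoot v∈ c with commuting⇒commonRoot u v c
  ... | w , i , j , u≈ , v≈ = ≈∈ (≈-sym u≈) (pow∈ (w∈ j v≈) i)
    where
    w∈ : ∀ j → v ≈ pow w j → P w
    w∈ j v≈ with j ℤ.≟ + 1 | j ℤ.≟ -[1+ 0 ]
    ... | yes refl | _ = ≈∈ (≈-trans v≈ (≈-reflexive (List.++-identityʳ w))) v∈
    ... | no _ | yes refl = ≈∈ (≈-trans (inv-cong v≈) (solve (w ∷ []) ((x₀ ⁻ ⊙ 𝟙) ⁻) x₀ refl)) (inv∈ v∈)
    ... | no j≢1 | no j≢-1 = contradiction v≈ (noRoot w j j≢1 j≢-1)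

-- The normal closure of the relators

concatMap-closed : {A : Set} (P : Word n → Set) {f : A → Word n} → P [] →
  (∀ {u v} → P u → P v → P (u ++ v)) → (∀ a → P (f a)) → ∀ as → P (concatMap f as)
concatMap-closed P []∈ ++∈ f∈ [] = []∈
concatMap-closed P []∈ ++∈ f∈ (a ∷ as) = ++∈ (f∈ a) (concatMap-closed P []∈ ++∈ f∈ as)

module _ {R : List (Word n)} where

  InN-elim : (P : Word n → Set) → (∀ {u v} → u ≈ v → P u → P v) → P [] →
    (∀ {u v} → P u → P v → P (u ++ v)) → (∀ j g → P (conj (lookup R j) g)) →
    (∀ j g → P (conj (inv (lookup R j)) g)) → ∀ {w} → InN R w → P w
  InN-elim P ≈∈ []∈ ++∈ r∈ r⁻¹∈ (cs , e) = ≈∈ (≈-sym e) (concatMap-closed P []∈ ++∈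
    (λ { (g , j , false) → r∈ j g ; (g , j , true) → r⁻¹∈ j g }) cs)

  InN-resp : ∀ {u v} → u ≈ v → InN R u → InN R v
  InN-resp e (cs , e′) = cs , ≈-trans (≈-sym e) e′

  InN-[] : InN R []
  InN-[] = [] , ≈-refl

  InN-++ : ∀ {u v} → InN R u → InN R v → InN R (u ++ v)
  InN-++ (cs , e) (ds , f) =
    cs ++ ds , ≈-trans (++-cong e f) (≈-reflexive (sym (List.concatMap-++ _ cs ds)))

  InN-relator : ∀ j g → InN R (conj (lookup R j) g)
  InN-relator j g = (g , j , false) ∷ [] , ≈-reflexive (sym (List.++-identityʳ _))

  InN-relator⁻¹ : ∀ j g → InN R (conj (inv (lookup R j)) g)
  InN-relator⁻¹ j g = (g , j , true) ∷ [] , ≈-reflexive (sym (List.++-identityʳ _))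

  InN-inv : ∀ {u} → InN R u → InN R (inv u)
  InN-inv = InN-elim (λ u → InN R (inv u)) (λ e → InN-resp (inv-cong e)) InN-[]
    (λ {u} {v} u∈ v∈ → InN-resp (≈-reflexive (sym (inv-++ u v))) (InN-++ v∈ u∈))
    (λ j g → InN-resp (solve (lookup R j ∷ g ∷ []) (x₀ ⁻ ^^ x₁) ((x₀ ^^ x₁) ⁻) refl) (InN-relator⁻¹ j g))
    (λ j g → InN-resp (solve (lookup R j ∷ g ∷ []) (x₀ ^^ x₁) ((x₀ ⁻ ^^ x₁) ⁻) refl) (InN-relator j g))

  InN-subgroup : IsSubgroup (InN R)
  InN-subgroup = record { ≈∈ = InN-resp ; []∈ = InN-[] ; ++∈ = InN-++ ; inv∈ = InN-inv }

  -- N is generated as a subgroup by all conjugates of the relators, so the condition is imposed on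
  -- each conjugate in place of normality of `P`.
  InN-least : {P : Word n → Set} → IsSubgroup P → (∀ j g → P (conj (lookup R j) g)) →
              ∀ {w} → InN R w → P w
  InN-least {P} sub r∈ = InN-elim P ≈∈ []∈ ++∈ r∈
    (λ j g → ≈∈ (solve (lookup R j ∷ g ∷ []) ((x₀ ^^ x₁) ⁻) (x₀ ⁻ ^^ x₁) refl) (inv∈ (r∈ j g)))
    where open IsSubgroup sub

  InN-conj : ∀ {u} h → InN R u → InN R (conj u h)
  InN-conj h = InN-least {λ u → InN R (conj u h)}
    (record
      { ≈∈ = λ e → InN-resp (conj-cong h e)
      ; []∈ = InN-resp (solve (h ∷ []) 𝟙 (𝟙 ^^ x₀) refl) InN-[]
      ; ++∈ = λ {u} {v} u∈ v∈ →
          InN-resp (solve (u ∷ v ∷ h ∷ []) (x₀ ^^ x₂ ⊙ x₁ ^^ x₂) ((x₀ ⊙ x₁) ^^ x₂) refl) (InN-++ u∈ v∈)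
      ; inv∈ = λ {u} u∈ → InN-resp (solve (u ∷ h ∷ []) ((x₀ ^^ x₁) ⁻) (x₀ ⁻ ^^ x₁) refl) (InN-inv u∈) })
    (λ j g → InN-resp (solve (lookup R j ∷ g ∷ h ∷ []) (x₀ ^^ (x₁ ⊙ x₂)) ((x₀ ^^ x₁) ^^ x₂) refl)
                      (InN-relator j (g ++ h)))

  InN-∈ : ∀ {r} → r ∈ R → InN R r
  InN-∈ {r} r∈ = InN-resp
    (≈-trans (solve (lookup R (index r∈) ∷ []) (x₀ ^^ 𝟙) x₀ refl) (≈-reflexive (sym (lookup-index r∈))))
    (InN-relator (index r∈) [])

-- Exponent sums

letterExp : Fin k → Letter k → ℤ
letterExp t (j , b) with j Fin.≟ t | b
... | yes _ | false = + 1
... | yes _ | true = -[1+ 0 ]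
... | no _ | _ = + 0

letterExp-invL : (t : Fin k) (x : Letter k) → letterExp t (invL x) ≡ - letterExp t x
letterExp-invL t (j , b) with j Fin.≟ t | b
... | yes _ | false = refl
... | yes _ | true = refl
... | no _ | _ = refl

expSum : Fin k → Word k → ℤ
expSum t = foldr (λ x e → letterExp t x + e) (+ 0)

expSum-++ : (t : Fin k) (u v : Word k) → expSum t (u ++ v) ≡ expSum t u + expSum t v
expSum-++ t [] v = sym (ℤ.+-identityˡ _)
expSum-++ t (x ∷ u) v =
  trans (cong (λ e → letterExp t x + e) (expSum-++ t u v)) (sym (ℤ.+-assoc (letterExp t x) _ _))

expSum-cong : (t : Fin k) {u v : Word k} → u ≈ v → expSum t u ≡ expSum t v
expSum-cong t ≈-refl = refl
expSum-cong t (≈-sym e) = sym (expSum-cong t e)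
expSum-cong t (≈-trans e f) = trans (expSum-cong t e) (expSum-cong t f)
expSum-cong t (≈-cancel u x v) = begin
  expSum t (u ++ x ∷ invL x ∷ v)
    ≡⟨ expSum-++ t u _ ⟩
  expSum t u + (letterExp t x + (letterExp t (invL x) + expSum t v))
    ≡⟨ cong (λ d → expSum t u + (letterExp t x + (d + expSum t v))) (letterExp-invL t x) ⟩
  expSum t u + (letterExp t x + (- letterExp t x + expSum t v))
    ≡⟨ cancel (expSum t u) (letterExp t x) (expSum t v) ⟩
  expSum t u + expSum t v
    ≡⟨ expSum-++ t u v ⟨
  expSum t (u ++ v) ∎
  where
  open ≡-Reasoning
  cancel : ∀ a x b → a + (x + (- x + b)) ≡ a + b
  cancel = solve-∀

expSum-inv : (t : Fin k) (w : Word k) → expSum t (inv w) ≡ - expSum t w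
expSum-inv t w = ℤ-inverse (trans (sym (expSum-++ t w (inv w))) (expSum-cong t (inverseʳ w)))
  where
  ℤ-inverse : ∀ {a b} → a + b ≡ + 0 → b ≡ - a
  ℤ-inverse {a} {b} eq = trans (lemma a b) (trans (cong (λ e → - a + e) eq) (ℤ.+-identityʳ (- a)))
    where
    lemma : ∀ a b → b ≡ - a + (a + b)
    lemma = solve-∀

expSum-conj : (t : Fin k) (w g : Word k) → expSum t (conj w g) ≡ expSum t w
expSum-conj t w g = begin
  expSum t (inv g ++ w ++ g)                    ≡⟨ expSum-++ t (inv g) (w ++ g) ⟩
  expSum t (inv g) + expSum t (w ++ g)          ≡⟨ cong₂ _+_ (expSum-inv t g) (expSum-++ t w g) ⟩
  - expSum t g + (expSum t w + expSum t g)      ≡⟨ cancel (expSum t g) (expSum t w) ⟩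
  expSum t w                                    ∎
  where
  open ≡-Reasoning
  cancel : ∀ a b → - a + (b + a) ≡ b
  cancel = solve-∀

expSum-gen : (t : Fin k) → expSum t (gen t) ≡ + 1
expSum-gen t with t Fin.≟ t
... | yes _ = refl
... | no ≢ = contradiction refl ≢

expSum-gen-≢ : {t j : Fin k} → j ≢ t → expSum t (gen j) ≡ + 0
expSum-gen-≢ {t = t} {j} j≢ with j Fin.≟ t
... | yes j≡ = contradiction j≡ j≢
... | no _ = refl

expSum-powℕ : (t : Fin k) (w : Word k) (i : ℕ) → expSum t (powℕ w i) ≡ + i * expSum t w
expSum-powℕ t w zero = refl
expSum-powℕ t w (suc i) = begin
  expSum t (w ++ powℕ w i)             ≡⟨ expSum-++ t w (powℕ w i) ⟩
  expSum t w + expSum t (powℕ w i)     ≡⟨ cong (λ e → expSum t w + e) (expSum-powℕ t w i) ⟩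
  expSum t w + + i * expSum t w        ≡⟨ ℤ.suc-* (+ i) (expSum t w) ⟨
  + suc i * expSum t w                 ∎
  where open ≡-Reasoning

expSum-pow : (t : Fin k) (w : Word k) (i : ℤ) → expSum t (pow w i) ≡ i * expSum t w
expSum-pow t w (+ i) = expSum-powℕ t w i
expSum-pow t w -[1+ i ] = begin
  expSum t (powℕ (inv w) (suc i))      ≡⟨ expSum-powℕ t (inv w) (suc i) ⟩
  + suc i * expSum t (inv w)           ≡⟨ cong (+ suc i *_) (expSum-inv t w) ⟩
  + suc i * - expSum t w               ≡⟨ ℤ.neg-distribʳ-* (+ suc i) (expSum t w) ⟨
  - (+ suc i * expSum t w)             ≡⟨ ℤ.neg-distribˡ-* (+ suc i) (expSum t w) ⟩
  -[1+ i ] * expSum t w                ∎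
  where open ≡-Reasoning

-- If the generator is the i-th power of w, comparing exponent sums gives 1 = i · e with e an
-- integer, so i is a unit of ℤ.
gen-noRoot : (t : Fin k) → NoRoot (gen t)
gen-noRoot t w i i≢1 i≢-1 e = unit i i≢1 i≢-1 (ℕ.m*n≡1⇒m≡1 ∣ i ∣ ∣ expSum t w ∣
  (trans (sym (ℤ.abs-* i (expSum t w))) (cong ∣_∣ (sym 1≡))))
  where
  1≡ : + 1 ≡ i * expSum t w
  1≡ = trans (sym (expSum-gen t)) (trans (expSum-cong t e) (expSum-pow t w i))
  unit : ∀ i → i ≢ + 1 → i ≢ -[1+ 0 ] → ∣ i ∣ ≢ 1
  unit (+ 1) ≢1 _ refl = ≢1 refl
  unit -[1+ 0 ] _ ≢-1 refl = ≢-1 refl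

-- Direct sums of two free groups

≈₂-refl : {y : Word p × Word q} → y ≈₂ y
≈₂-refl = ≈-refl , ≈-refl

≈₂-sym : {y z : Word p × Word q} → y ≈₂ z → z ≈₂ y
≈₂-sym (e , f) = ≈-sym e , ≈-sym f

≈₂-trans : {x y z : Word p × Word q} → x ≈₂ y → y ≈₂ z → x ≈₂ z
≈₂-trans (e , f) (e′ , f′) = ≈-trans e e′ , ≈-trans f f′

·₂-cong : {x x′ y y′ : Word p × Word q} → x ≈₂ x′ → y ≈₂ y′ → (x ·₂ y) ≈₂ (x′ ·₂ y′)
·₂-cong (e , f) (e′ , f′) = ++-cong e e′ , ++-cong f f′

inv₂-cong : {y z : Word p × Word q} → y ≈₂ z → inv₂ y ≈₂ inv₂ z
inv₂-cong (e , f) = inv-cong e , inv-cong f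

conj₂ : Word p × Word q → Word p × Word q → Word p × Word q
conj₂ y s = inv₂ s ·₂ (y ·₂ s)

conj₂-cong : {y y′ s s′ : Word p × Word q} → y ≈₂ y′ → s ≈₂ s′ → conj₂ y s ≈₂ conj₂ y′ s′
conj₂-cong e f = ·₂-cong (inv₂-cong f) (·₂-cong e f)

⟦_⟧₂ : Expr k → Vec (Word p × Word q) k → Word p × Word q
⟦ e ⟧₂ ρ = ⟦ e ⟧ (proj₁ ∘ Vec.lookup ρ) , ⟦ e ⟧ (proj₂ ∘ Vec.lookup ρ)

solve₂ : (ρ : Vec (Word p × Word q) k) (e f : Expr k) → norm (⟦ e ⟧ gen) ≡ norm (⟦ f ⟧ gen) →
         ⟦ e ⟧₂ ρ ≈₂ ⟦ f ⟧₂ ρ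
solve₂ ρ e f eq = solve′ (proj₁ ∘ Vec.lookup ρ) e f eq , solve′ (proj₂ ∘ Vec.lookup ρ) e f eq

-- Hurwitz moves

Hurwitz-++ : ∀ r {s t} → Hurwitz s t → Hurwitz (r ++ s) (r ++ t)
Hurwitz-++ [] h = h
Hurwitz-++ (x ∷ r) h = cons x (Hurwitz-++ r h)
  where
  cons : ∀ x {s t} → Hurwitz s t → Hurwitz (x ∷ s) (x ∷ t)
  cons x (h-eq e) = h-eq (≈₂-refl ∷ e)
  cons x (h-step b) = h-step (there x b)
  cons x (h-sym h) = h-sym (cons x h)
  cons x (h-trans h h′) = h-trans (cons x h) (cons x h′)

PwEq-refl : ∀ t → PwEq t t
PwEq-refl [] = []
PwEq-refl (x ∷ t) = ≈₂-refl ∷ PwEq-refl t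

-- Moving to the right, x is conjugated first by the inverse of p and then by p, so it emerges
-- unchanged.
pass-inverse-pair : ∀ x p s → Hurwitz (x ∷ inv₂ p ∷ p ∷ s) (inv₂ p ∷ p ∷ x ∷ s)
pass-inverse-pair x p s =
  h-trans (h-step (σ x (inv₂ p) (p ∷ s)))
  (h-trans (h-step (there _ (σ _ p s)))
  (h-eq (≈₂-refl ∷ ≈₂-refl ∷
    solve₂ (x ∷ p ∷ []) ((x₀ ^^ (x₁ ⁻)) ^^ x₁) x₀ refl ∷ PwEq-refl s)))

gather-inverse-pair : ∀ t p → Hurwitz (t ++ inv₂ p ∷ p ∷ []) (inv₂ p ∷ p ∷ t)
gather-inverse-pair [] p = h-eq (PwEq-refl _)
gather-inverse-pair (x ∷ t) p =
  h-trans (Hurwitz-++ [ x ] (gather-inverse-pair t p)) (pass-inverse-pair x p t)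

-- The pair is brought directly in front of h. Passing p and then its inverse to the right across h
-- conjugates both by h and leaves h intact; the pair then returns to the end.
conjugate-inverse-pair : ∀ {h t} → h ∈ t → ∀ p →
  Hurwitz (t ++ inv₂ p ∷ p ∷ []) (t ++ inv₂ (conj₂ p h) ∷ conj₂ p h ∷ [])
conjugate-inverse-pair {h} h∈ p with ∈-∃++ h∈
... | t , t′ , refl =
  subst₂ Hurwitz (sym (List.++-assoc t (h ∷ t′) _)) (sym (List.++-assoc t (h ∷ t′) _))
    (Hurwitz-++ t
      (h-trans (gather-inverse-pair (h ∷ t′) p)
      (h-trans (h-step (there _ (σ p h t′)))
      (h-trans (h-step (σ (inv₂ p) h _))
      (h-trans (h-eq (≈₂-refl ∷ solve₂ (p ∷ h ∷ []) (x₀ ⁻ ^^ x₁) ((x₀ ^^ x₁) ⁻) refl ∷ PwEq-refl _))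
      (Hurwitz-++ [ h ] (h-sym (gather-inverse-pair t′ (conj₂ p h)))))))))

-- Invariants of Hurwitz orbits

module _ (P : Word 2 × Word 2 → Set) (resp : ∀ {x y} → x ≈₂ y → P x → P y)
         (conj∈ : ∀ {f g} → P f → P g → P (conj₂ f g))
         (conj⁻¹∈ : ∀ {f g} → P f → P g → P (g ·₂ (f ·₂ inv₂ g))) where

  private
    All-PwEq : ∀ {s t} → PwEq s t → All P s → All P t
    All-PwEq [] [] = []
    All-PwEq (e ∷ es) (x ∷ xs) = resp e x ∷ All-PwEq es xs

    PwEq-sym : ∀ {s t} → PwEq s t → PwEq t s
    PwEq-sym [] = []
    PwEq-sym (e ∷ es) = ≈₂-sym e ∷ PwEq-sym es

    All-step : ∀ {s t} → BraidStep s t → All P s ⇔ All P t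
    All-step (σ f g t) = mk⇔
      (λ { (f∈ ∷ g∈ ∷ t∈) → g∈ ∷ conj∈ f∈ g∈ ∷ t∈ })
      (λ { (g∈ ∷ f∈ ∷ t∈) →
        resp (solve₂ (f ∷ g ∷ []) (x₁ ⊙ (x₀ ^^ x₁) ⊙ x₁ ⁻) x₀ refl) (conj⁻¹∈ f∈ g∈) ∷ g∈ ∷ t∈ })
    All-step (σ⁻¹ f g t) = mk⇔
      (λ { (f∈ ∷ g∈ ∷ t∈) → conj⁻¹∈ g∈ f∈ ∷ f∈ ∷ t∈ })
      (λ { (g∈ ∷ f∈ ∷ t∈) →
        f∈ ∷ resp (solve₂ (f ∷ g ∷ []) ((x₀ ⊙ x₁ ⊙ x₀ ⁻) ^^ x₀) x₁ refl) (conj∈ g∈ f∈) ∷ t∈ })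
    All-step (there h b) with All-step b
    ... | mk = mk⇔ (λ { (x ∷ xs) → x ∷ Equivalence.to mk xs })
                   (λ { (x ∷ xs) → x ∷ Equivalence.from mk xs })

  -- Both implications are carried through the induction because `h-sym` reverses a move; this is
  -- why closure under conjugation by inverses is among the hypotheses.
  Hurwitz-All : ∀ {s t} → Hurwitz s t → All P s ⇔ All P t
  Hurwitz-All (h-eq e) = mk⇔ (All-PwEq e) (All-PwEq (PwEq-sym e))
  Hurwitz-All (h-step b) = All-step b
  Hurwitz-All (h-sym h) = mk⇔ (Equivalence.from (Hurwitz-All h)) (Equivalence.to (Hurwitz-All h))
  Hurwitz-All (h-trans h h′) = mk⇔
    (Equivalence.to (Hurwitz-All h′) ∘ Equivalence.to (Hurwitz-All h))
    (Equivalence.from (Hurwitz-All h) ∘ Equivalence.from (Hurwitz-All h′))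

-- Images under the embedding

module _ (i : InjHom n) where

  fun-1 : fun i ([] , []) ≈₂ ([] , [])
  fun-1 = idempotent (hom i ([] , []) ([] , []))
    where
    idempotent : ∀ {y} → y ≈₂ (y ·₂ y) → y ≈₂ ([] , [])
    idempotent {y} e = ≈₂-trans (solve₂ (y ∷ []) x₀ (x₀ ⁻ ⊙ x₀ ⊙ x₀) refl)
      (≈₂-trans (·₂-cong ≈₂-refl (≈₂-sym e)) (solve₂ (y ∷ []) (x₀ ⁻ ⊙ x₀) 𝟙 refl))

  fun-inv : ∀ y → fun i (inv₂ y) ≈₂ inv₂ (fun i y)
  fun-inv y = inv-unique _ _ (proj₁ e) , inv-unique _ _ (proj₂ e)
    where
    e : (fun i y ·₂ fun i (inv₂ y)) ≈₂ ([] , [])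
    e = ≈₂-trans (≈₂-sym (hom i y (inv₂ y)))
          (≈₂-trans (resp i (solve₂ (y ∷ []) (x₀ ⊙ x₀ ⁻) 𝟙 refl)) fun-1)

  fun-conj : ∀ y s → fun i (conj₂ y s) ≈₂ conj₂ (fun i y) (fun i s)
  fun-conj y s = ≈₂-trans (hom i (inv₂ s) (y ·₂ s)) (·₂-cong (fun-inv s) (hom i y s))

  inversePair : Word n × Word (suc n) → Tuple
  inversePair y = fun i (inv₂ y) ∷ fun i y ∷ []

  inversePair-cong : ∀ {y z} → y ≈₂ z → Hurwitz (inversePair y) (inversePair z)
  inversePair-cong e = h-eq (resp i (inv₂-cong e) ∷ resp i e ∷ [])

  -- For fixed t these s form a subgroup containing every s whose image is an entry of t; the lemmas
  -- below are its closure properties.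
  record Conjugates (t : Tuple) (s : Word n × Word (suc n)) : Set where
    constructor conjugates
    field conjugate : ∀ y → Hurwitz (t ++ inversePair y) (t ++ inversePair (conj₂ y s))
  open Conjugates

  module _ {t : Tuple} where

    Conjugates-∈ : ∀ {s} → fun i s ∈ t → Conjugates t s
    Conjugates-∈ {s} s∈ = conjugates λ y →
      h-trans (Hurwitz-++ t (h-eq (fun-inv y ∷ ≈₂-refl ∷ [])))
      (h-trans (conjugate-inverse-pair s∈ (fun i y))
      (Hurwitz-++ t (h-eq (≈₂-trans (inv₂-cong (≈₂-sym (fun-conj y s))) (≈₂-sym (fun-inv (conj₂ y s)))
                           ∷ ≈₂-sym (fun-conj y s) ∷ []))))

    Conjugates-resp : ∀ {s s′} → s ≈₂ s′ → Conjugates t s → Conjugates t s′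
    Conjugates-resp e C = conjugates λ y → h-trans (conjugate C y) (Hurwitz-++ t (inversePair-cong (conj₂-cong ≈₂-refl e)))

    Conjugates-1 : Conjugates t ([] , [])
    Conjugates-1 = conjugates λ y → Hurwitz-++ t (inversePair-cong (solve₂ (y ∷ []) x₀ (x₀ ^^ 𝟙) refl))

    Conjugates-· : ∀ {s s′} → Conjugates t s → Conjugates t s′ → Conjugates t (s ·₂ s′)
    Conjugates-· {s} {s′} C C′ = conjugates λ y → h-trans (conjugate C y) (h-trans (conjugate C′ (conj₂ y s))
      (Hurwitz-++ t (inversePair-cong
        (solve₂ (y ∷ s ∷ s′ ∷ []) ((x₀ ^^ x₁) ^^ x₂) (x₀ ^^ (x₁ ⊙ x₂)) refl))))

    Conjugates-inv : ∀ {s} → Conjugates t s → Conjugates t (inv₂ s)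
    -- Conjugating y^(s⁻¹) by s gives back y; this equivalence is read backwards.
    Conjugates-inv {s} C = conjugates λ y → h-sym (h-trans (conjugate C (conj₂ y (inv₂ s)))
      (Hurwitz-++ t (inversePair-cong (solve₂ (y ∷ s ∷ []) ((x₀ ^^ (x₁ ⁻)) ^^ x₁) x₀ refl))))

-- The two directions of the theorem

zip-map-++ : {A B C : Set} (f : A → B) (g : A → C) (xs : List A) (bs : List B) (cs : List C) →
  zip (map f xs ++ bs) (map g xs ++ cs) ≡ map (λ x → f x , g x) xs ++ zip bs cs
zip-map-++ f g [] bs cs = refl
zip-map-++ f g (x ∷ xs) bs cs = cong ((f x , g x) ∷_) (zip-map-++ f g xs bs cs)

module _ (R : List (Word n)) (i : InjHom n) (H : Word n) where
  open FTL R i H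

  private
    top : Fin (suc n)
    top = fromℕ n

    -- The entries independent of c: only the final inverse pair of `FTL-s1 c` varies.
    base : List (Word n × Word (suc n))
    base = map (λ r → r , []) Vf ++ zip Ws Xs

  FTL-s1-split : ∀ c → FTL-s1 c ≡ map (fun i) base ++ inversePair i (c , Xn+1)
  FTL-s1-split c = trans (cong (map (fun i)) (sym (List.++-assoc (map (λ r → r , []) Vf) (zip Ws Xs) _)))
                         (List.map-++ (fun i) base _)

  zip-Ws-Xs : zip Ws Xs ≡ map (λ j → gen j , Xgen j) (allFin n) ++
    [ inv (concat (map gen (allFin n))) , inv (concat (map Xgen (allFin n))) ]
  zip-Ws-Xs = zip-map-++ gen Xgen (allFin n) _ _

  -- The entries (z_j, X_j) let any g act through its lift (g, g(X)). Conjugating the entry (r, 1)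
  -- by this lift yields (r^g, 1), and such elements generate N in the first coordinate.
  Conjugates-InN : ∀ {w} → InN R w → Conjugates i (map (fun i) base) (w , [])
  Conjugates-InN = InN-least
    (record
      { ≈∈ = λ e → Conjugates-resp i (e , ≈-refl)
      ; []∈ = Conjugates-1 i
      ; ++∈ = Conjugates-· i
      ; inv∈ = Conjugates-inv i })
    (λ j g → Conjugates-resp i
      (≈-refl , solve (substW Xgen g ∷ []) (𝟙 ^^ x₀) 𝟙 refl)
      (Conjugates-· i (Conjugates-inv i (lift g)) (Conjugates-· i (relator j) (lift g))))
    where
    C = Conjugates i (map (fun i) base)
    relator : ∀ j → C (lookup R j , [])
    relator j = Conjugates-∈ i
      (∈-map⁺ (fun i) (∈-++⁺ˡ (∈-map⁺ (λ r → r , []) (∈-++⁺ˡ (∈-lookup {xs = R} j)))))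
    generator : ∀ j → C (gen j , Xgen j)
    generator j = Conjugates-∈ i (∈-map⁺ (fun i) (∈-++⁺ʳ (map (λ r → r , []) Vf)
      (subst ((gen j , Xgen j) ∈_) (sym zip-Ws-Xs) (∈-++⁺ˡ (∈-map⁺ (λ j → gen j , Xgen j) (∈-allFin j))))))
    lift : ∀ g → C (g , substW Xgen g)
    lift [] = Conjugates-1 i
    lift ((j , false) ∷ g) = Conjugates-· i (generator j) (lift g)
    lift ((j , true) ∷ g) = Conjugates-· i (Conjugates-inv i (generator j)) (lift g)

  equal⇒Hurwitz : ∀ a b → EqInG R a b → Hurwitz (FTL-B a) (FTL-B b)
  equal⇒Hurwitz a b a≡b = subst₂ Hurwitz (sym (FTL-s1-split (conj H a))) (sym (FTL-s1-split (conj H b)))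
    -- Conjugation by (a⁻¹b, 1) turns H^a into H^b and fixes X_{n+1}.
    (h-trans (Conjugates.conjugate (Conjugates-InN a⁻¹b∈) (conj H a , Xn+1))
             (Hurwitz-++ (map (fun i) base) (inversePair-cong i
               ( solve (H ∷ a ∷ b ∷ []) ((x₀ ^^ x₁) ^^ (x₁ ⁻ ⊙ x₂)) (x₀ ^^ x₂) refl
               , solve (Xn+1 ∷ []) (x₀ ^^ 𝟙) x₀ refl))))
    where
    a⁻¹b∈ : InN R (inv a ++ b)
    a⁻¹b∈ = InN-resp (solve (a ∷ b ∷ []) ((x₀ ⊙ x₁ ⁻) ⁻ ^^ x₀) (x₀ ⁻ ⊙ x₁) refl)
                     (InN-conj a (InN-inv a≡b))

  -- The homomorphism `ψ` and its graph modulo N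

  private
    ψ₀ : Fin (suc n) → Word n
    ψ₀ j with view j
    ... | ‵fromℕ = []
    ... | ‵inject₁ j = gen j

    ψ : Word (suc n) → Word n
    ψ = substW ψ₀

    ψ-Xn+1 : ψ Xn+1 ≡ []
    ψ-Xn+1 rewrite view-fromℕ n = refl

  -- The subgroup generated by the tuple is, modulo N, contained in the graph of ψ.
  record Graph (y : Word n × Word (suc n)) : Set where
    constructor graph
    field over : InN R (proj₁ y ++ inv (ψ (proj₂ y)))

  Graph-resp : ∀ {y z} → y ≈₂ z → Graph y → Graph z
  Graph-resp (e , f) (graph G) = graph (InN-resp (++-cong e (inv-cong (substW-cong ψ₀ f))) G)

  -- Over the kernel of `ψ` the graph reduces to N. This puts (c, X_{n+1}) into the graph for c in
  -- N, and at the end extracts that the conjugating element lies in N.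
  Graph-InN : ∀ {u x} → ψ x ≈ [] → InN R u ⇔ Graph (u , x)
  Graph-InN {u} {x} e = mk⇔ (graph ∘ InN-resp (≈-sym u≈)) (InN-resp u≈ ∘ Graph.over)
    where
    u≈ : u ++ inv (ψ x) ≈ u
    u≈ = ≈-trans (++-congˡ u (inv-cong e)) (≈-reflexive (List.++-identityʳ u))

  -- Normality of N is what makes the graph closed under products: the factor coming from z has to
  -- be conjugated by the inverse of `ψ x`.
  Graph-· : ∀ {y z} → Graph y → Graph z → Graph (y ·₂ z)
  Graph-· {u , x} {v , y} (graph Gx) (graph Gy) = graph (InN-resp
    (≈-trans (solve (u ∷ ψ x ∷ v ∷ ψ y ∷ []) ((x₀ ⊙ x₁ ⁻) ⊙ (x₂ ⊙ x₃ ⁻) ^^ (x₁ ⁻)) ((x₀ ⊙ x₂) ⊙ (x₁ ⊙ x₃) ⁻) refl)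
             (++-congˡ (u ++ v) (inv-cong (≈-reflexive (sym (substW-++ ψ₀ x y))))))
    (InN-++ Gx (InN-conj (inv (ψ x)) Gy)))

  Graph-inv : ∀ {y} → Graph y → Graph (inv₂ y)
  Graph-inv {u , x} (graph Gx) = graph (InN-resp
    (≈-trans (solve (u ∷ ψ x ∷ []) ((x₀ ⊙ x₁ ⁻) ⁻ ^^ x₁) (x₀ ⁻ ⊙ x₁ ⁻ ⁻) refl)
             (++-congˡ (inv u) (inv-cong (≈-sym (substW-inv ψ₀ x)))))
    (InN-conj (ψ x) (InN-inv Gx)))

  Graph-conj : ∀ {y s} → Graph y → Graph s → Graph (conj₂ y s)
  Graph-conj {y} {s} Gy Gs = Graph-· {inv₂ s} {y ·₂ s} (Graph-inv {s} Gs) (Graph-· {y} {s} Gy Gs)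

  -- Exponent sum zero separates the base entries and all their conjugates from those of (c,
  -- X_{n+1}), whose sum is one.
  Graph₀ : Word n × Word (suc n) → Set
  Graph₀ y = Graph y × expSum top (proj₂ y) ≡ + 0

  Graph₀-inv : ∀ {y} → Graph₀ y → Graph₀ (inv₂ y)
  Graph₀-inv {y} (G , e) = Graph-inv {y} G , trans (expSum-inv top (proj₂ y)) (cong -_ e)

  Graph₀-gen : ∀ j → Graph₀ (gen j , Xgen j)
  Graph₀-gen j =
    graph (InN-resp (≈-trans (≈-sym (inverseʳ (gen j)))
      (++-congˡ (gen j) (inv-cong (≈-reflexive (sym ψ-gen))))) InN-[])
    , expSum-gen-≢ {t = top} {inject₁ j} (Fin.fromℕ≢inject₁ ∘ sym)
    where
    ψ-gen : ψ (Xgen j) ≡ gen j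
    ψ-gen rewrite view-inject₁ j = refl

  Graph₀-gens : ∀ js → Graph₀ (concat (map gen js) , concat (map Xgen js))
  Graph₀-gens [] = graph InN-[] , refl
  Graph₀-gens (j ∷ js) with Graph₀-gen j | Graph₀-gens js
  ... | Gj , ej | Gs , es = Graph-· {gen j , Xgen j} Gj Gs ,
    trans (expSum-++ top (Xgen j) (concat (map Xgen js))) (cong₂ _+_ ej es)

  Graph₀-InN : ∀ {u} → InN R u → Graph₀ (u , [])
  Graph₀-InN u∈ = Equivalence.to (Graph-InN {x = []} ≈-refl) u∈ , refl

  Graph₀-base : All Graph₀ base
  Graph₀-base = ++⁺
    (map⁺ (++⁺ (All.tabulate (Graph₀-InN ∘ InN-∈)) (Graph₀-InN (InN-inv concat∈) ∷ [])))
    (subst (All Graph₀) (sym zip-Ws-Xs)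
      (++⁺ (map⁺ (universal Graph₀-gen (allFin n))) (Graph₀-inv (Graph₀-gens (allFin n)) ∷ [])))
    where
    concat∈ : InN R (concat R)
    concat∈ = go R (All.tabulate InN-∈)
      where
      go : ∀ rs → All (InN R) rs → InN R (concat rs)
      go [] [] = InN-[]
      go (r ∷ rs) (r∈ ∷ rs∈) = InN-++ r∈ (go rs rs∈)

  -- The property preserved by Hurwitz moves, with S enlarged to the graph. The first alternative
  -- covers the base entries, of sum 0, and the inverse of (c, X_{n+1}), of sum -1.
  Orbit : Word n → Word n × Word (suc n) → Set
  Orbit c y = Graph y × (expSum top (proj₂ y) ≢ + 1 ⊎ (∃ λ s → Graph s × y ≈₂ conj₂ (c , Xn+1) s))

  Orbit-resp : ∀ {c y z} → y ≈₂ z → Orbit c y → Orbit c z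
  Orbit-resp {y = y} {z} e (G , inj₁ ≢1) =
    Graph-resp {y} {z} e G , inj₁ (≢1 ∘ trans (expSum-cong top (proj₂ e)))
  Orbit-resp {y = y} {z} e (G , inj₂ (s , Gs , y≈)) =
    Graph-resp {y} {z} e G , inj₂ (s , Gs , ≈₂-trans (≈₂-sym e) y≈)

  Orbit-conj : ∀ {c y s} → Orbit c y → Graph s → Orbit c (conj₂ y s)
  Orbit-conj {y = y} {s} (G , inj₁ ≢1) Gs =
    Graph-conj {y} {s} G Gs , inj₁ (≢1 ∘ trans (sym (expSum-conj top (proj₂ y) (proj₂ s))))
  Orbit-conj {c} {y} {s} (G , inj₂ (s′ , Gs′ , y≈)) Gs =
    Graph-conj {y} {s} G Gs , inj₂ (s′ ·₂ s , Graph-· {s′} {s} Gs′ Gs ,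
      ≈₂-trans (conj₂-cong {s = s} {s} y≈ ≈₂-refl)
        (solve₂ ((c , Xn+1) ∷ s′ ∷ s ∷ []) ((x₀ ^^ x₁) ^^ x₂) (x₀ ^^ (x₁ ⊙ x₂)) refl))

  FunOrbit : Word n → Word 2 × Word 2 → Set
  FunOrbit c f = ∃ λ y → f ≈₂ fun i y × Orbit c y

  FunOrbit-conj : ∀ {c f g} → FunOrbit c f → FunOrbit c g → FunOrbit c (conj₂ f g)
  FunOrbit-conj (y , f≈ , Oy) (z , g≈ , Oz) =
    conj₂ y z , ≈₂-trans (conj₂-cong f≈ g≈) (≈₂-sym (fun-conj i y z)) , Orbit-conj {y = y} {z} Oy (proj₁ Oz)

  FunOrbit-conj⁻¹ : ∀ {c f g} → FunOrbit c f → FunOrbit c g → FunOrbit c (g ·₂ (f ·₂ inv₂ g))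
  FunOrbit-conj⁻¹ {f = f} {g} (y , f≈ , Oy) (z , g≈ , Oz) =
    conj₂ y (inv₂ z) ,
    ≈₂-trans (solve₂ (f ∷ g ∷ []) (x₁ ⊙ x₀ ⊙ x₁ ⁻) (x₀ ^^ (x₁ ⁻)) refl)
      (≈₂-trans (conj₂-cong f≈ (≈₂-trans (inv₂-cong g≈) (≈₂-sym (fun-inv i z)))) (≈₂-sym (fun-conj i y (inv₂ z)))) ,
    Orbit-conj {y = y} {inv₂ z} Oy (Graph-inv {z} (proj₁ Oz))

  Orbit-FTL : ∀ {c} → InN R c → All (FunOrbit c) (FTL-s1 c)
  Orbit-FTL {c} c∈ = subst (All (FunOrbit c)) (sym (FTL-s1-split c))
    (++⁺ (map⁺ (All.map (λ {y} G₀ → y , ≈₂-refl , proj₁ G₀ , inj₁ (λ e → 0≢1 (trans (sym (proj₂ G₀)) e))) Graph₀-base))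
      ((inv₂ cX , ≈₂-refl , Graph-inv {cX} G , inj₁ -1≢1) ∷
       (cX , ≈₂-refl , G , inj₂ (([] , []) , graph InN-[] , solve₂ (cX ∷ []) x₀ (x₀ ^^ 𝟙) refl)) ∷ []))
    where
    cX = c , Xn+1
    G : Graph cX
    G = Equivalence.to (Graph-InN (≈-reflexive ψ-Xn+1)) c∈
    0≢1 : + 0 ≢ + 1
    0≢1 ()
    -1≢1 : expSum top (inv Xn+1) ≢ + 1
    -1≢1 e with trans (sym (trans (expSum-inv top Xn+1) (cong -_ (expSum-gen top)))) e
    ... | ()

  Hurwitz⇒Orbit : ∀ c d → InN R c → Hurwitz (FTL-s1 c) (FTL-s1 d) → Orbit c (d , Xn+1)
  Hurwitz⇒Orbit c d c∈ h = last (++⁻ʳ (map (fun i) base) (subst (All (FunOrbit c)) (FTL-s1-split d)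
    (Equivalence.to (Hurwitz-All (FunOrbit c) (λ { e (y , f≈ , Oy) → y , ≈₂-trans (≈₂-sym e) f≈ , Oy })
      FunOrbit-conj FunOrbit-conj⁻¹ h) (Orbit-FTL c∈))))
    where
    last : All (FunOrbit c) (inversePair i (d , Xn+1)) → Orbit c (d , Xn+1)
    -- Injectivity of `i` identifies the preimage y supplied by the invariant with (d, X_{n+1}).
    last (_ ∷ (y , e , Oy) ∷ []) = Orbit-resp {c} {y} {d , Xn+1} (≈₂-sym (inj i e)) Oy

  -- From conjugate final entries to equality in G

  Orbit⇒conjugate : ∀ c d → Orbit c (d , Xn+1) → ∃ λ g → InN R g × d ≈ conj c g
  Orbit⇒conjugate c d (_ , inj₁ ≢1) = contradiction (expSum-gen top) ≢1
  Orbit⇒conjugate c d (_ , inj₂ ((g , x) , Gg , dX≈)) = g , g∈ , proj₁ dX≈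
    where
    -- The second coordinate says that conjugation by x fixes X_{n+1}.
    commute : x ++ Xn+1 ≈ Xn+1 ++ x
    commute = ≈-trans (++-congˡ x (proj₂ dX≈)) (solve (Xn+1 ∷ x ∷ []) (x₁ ⊙ x₀ ^^ x₁) (x₀ ⊙ x₁) refl)
    ψ-kernel : IsSubgroup (λ w → ψ w ≈ [])
    ψ-kernel = record
      { ≈∈ = λ e ψ≈ → ≈-trans (substW-cong ψ₀ (≈-sym e)) ψ≈
      ; []∈ = ≈-refl
      ; ++∈ = λ {u} {v} e f → ≈-trans (≈-reflexive (substW-++ ψ₀ u v)) (++-cong e f)
      ; inv∈ = λ {u} e → ≈-trans (substW-inv ψ₀ u) (inv-cong e) }
    g∈ : InN R g
    -- The kernel of `ψ` contains X_{n+1}, hence also its centralizing element x; over that kernel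
    -- the graph is N.
    g∈ = Equivalence.from (Graph-InN
      (IsSubgroup.centralizer∈ ψ-kernel (gen-noRoot top) (≈-reflexive ψ-Xn+1) commute)) Gg

  conjugate⇒equal : InN R H → NoRoot H → ∀ a b →
                    (∃ λ g → InN R g × conj H b ≈ conj (conj H a) g) → EqInG R a b
  conjugate⇒equal H∈ noRoot a b (g , g∈ , Hb≈) = InN-resp
    -- The word ab⁻¹ splits as agb⁻¹ times bg⁻¹b⁻¹: the first factor centralizes H, the second is a
    -- conjugate of an element of N.
    (solve (a ∷ g ∷ b ∷ []) ((x₀ ⊙ x₁ ⊙ x₂ ⁻) ⊙ (x₁ ⁻ ^^ (x₂ ⁻))) (x₀ ⊙ x₂ ⁻) refl)
    (InN-++ (IsSubgroup.centralizer∈ InN-subgroup noRoot H∈ commute) (InN-conj (inv b) (InN-inv g∈)))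
    where
    open ≈-Reasoning
    commute : (a ++ g ++ inv b) ++ H ≈ H ++ (a ++ g ++ inv b)
    commute = begin
      (a ++ g ++ inv b) ++ H
        ≈⟨ solve (a ∷ g ∷ b ∷ H ∷ []) ((x₀ ⊙ x₁ ⊙ x₂ ⁻) ⊙ x₃) (x₀ ⊙ x₁ ⊙ (x₃ ^^ x₂) ⊙ x₂ ⁻) refl ⟩
      a ++ g ++ conj H b ++ inv b
        ≈⟨ ++-congˡ a (++-congˡ g (++-congʳ (inv b) Hb≈)) ⟩
      a ++ g ++ conj (conj H a) g ++ inv b
        ≈⟨ solve (a ∷ g ∷ b ∷ H ∷ []) (x₀ ⊙ x₁ ⊙ ((x₃ ^^ x₀) ^^ x₁) ⊙ x₂ ⁻) (x₃ ⊙ (x₀ ⊙ x₁ ⊙ x₂ ⁻)) refl ⟩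
      H ++ (a ++ g ++ inv b) ∎

  Hurwitz⇒equal : InN R H → NoRoot H → ∀ a b → Hurwitz (FTL-B a) (FTL-B b) → EqInG R a b
  Hurwitz⇒equal H∈ noRoot a b h = conjugate⇒equal H∈ noRoot a b
    (Orbit⇒conjugate (conj H a) (conj H b) (Hurwitz⇒Orbit (conj H a) (conj H b) (InN-conj a H∈) h))

theorem4p8 : (n : ℕ) → 2 ≤ n → (R : List (Word n))
    → Any (λ r → ¬ (r ≈ [])) R
    → (i : InjHom n) → (H : Word n) → InN R H → NoRoot H
    → (a b : Word n)
    → EqInG R a b ⇔ Hurwitz (FTL.FTL-B R i H a) (FTL.FTL-B R i H b)
theorem4p8 n _ R _ i H H∈ noRoot a b =
  mk⇔ (equal⇒Hurwitz R i H a b) (Hurwitz⇒equal R i H H∈ noRoot a b)
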